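{- The number of order-different XOS functions on $V=[n]$ (i.e., the number of order-equivalence classes of XOS functions $f\colon 2^{[n]}\to\mathbb{R}$) is $2^{2^{\Theta(n)}}$.
   Context: A set function $g\colon 2^V\to\mathbb{R}$ is additive if $g(X)=\sum_{v\in X}g(\{v\})$ for all $X\subseteq V$. A function $f\colon 2^V\to\mathbb{R}$ is XOS if there are finitely many additive functions $f_1,\dots,f_k\colon 2^V\to\mathbb{R}$ (values may be negative) with $f(X)=\max_{i\in[k]}f_i(X)$ for all $X\subseteq V$. Two set functions $f,g\colon 2^V\to\mathbb{R}$ are order-equivalent if for all $X,Y\subseteq V$, $f(X)\le f(Y)$ if and only if $g(X)\le g(Y)$; otherwise they are order-different. -}

module Defs where

open import Algebra.Bundles using (CommutativeMonoid)
import Algebra.Properties.CommutativeSemigroup as CommutativeSemigroupProperties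
open import Data.Bool.Base using (if_then_else_)
open import Data.Fin.Base using (Fin)
open import Data.Fin.Subset using (Subset; ⁅_⁆)
open import Data.Integer.Base using (+_)
open import Data.Nat.Base as ℕ using (ℕ; suc)
import Data.Nat.Properties as ℕₚ
open import Data.Product.Base using (Σ-syntax; ∃-syntax; _×_; _,_)
open import Data.Rational.Base as ℚ using (ℚ; 0ℚ; ½)
import Data.Rational.Properties as ℚₚ
open import Data.Vec.Base using (lookup)
open import Data.Vec.Functional using (Vector; foldr; head; tail)
open import Function.Bundles using (_⇔_)
open import Relation.Binary.PropositionalEquality
  using (_≡_; _≢_; sym; trans; cong; subst)
open import Relation.Nullary using (¬_)

-- Reals are Cauchy sequences of rationals, taken up to _≃_.  The condition
-- below is symmetric in m and n, so it says ∣ x m - x n ∣ ≤ ε.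
IsCauchy : (ℕ → ℚ) → Set
IsCauchy x = ∀ ε → 0ℚ ℚ.< ε →
  ∃[ N ] (∀ m n → N ℕ.≤ m → N ℕ.≤ n → x m ℚ.≤ x n ℚ.+ ε)

record ℝ : Set where
  constructor mkℝ
  field
    seq    : ℕ → ℚ
    cauchy : IsCauchy seq

open ℝ public

infix  4 _≤_ _≃_
infixl 6 _+_ _⊔_

_≤_ : ℝ → ℝ → Set
x ≤ y = ∀ ε → 0ℚ ℚ.< ε →
  ∃[ N ] (∀ n → N ℕ.≤ n → seq x n ℚ.≤ seq y n ℚ.+ ε)

_≃_ : ℝ → ℝ → Set
x ≃ y = x ≤ y × y ≤ x

private
  p≤p+ε : ∀ p {ε} → 0ℚ ℚ.< ε → p ℚ.≤ p ℚ.+ ε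
  p≤p+ε p {ε} 0<ε =
    subst (ℚ._≤ p ℚ.+ ε) (ℚₚ.+-identityʳ p) (ℚₚ.+-monoʳ-≤ p (ℚₚ.<⇒≤ 0<ε))

  half-pos : ∀ ε → 0ℚ ℚ.< ε → 0ℚ ℚ.< ½ ℚ.* ε
  half-pos ε 0<ε =
    subst (ℚ._< ½ ℚ.* ε) (ℚₚ.*-zeroʳ ½) (ℚₚ.*-monoʳ-<-pos ½ 0<ε)

  half+half : ∀ ε → ½ ℚ.* ε ℚ.+ ½ ℚ.* ε ≡ ε
  half+half ε = trans (sym (ℚₚ.*-distribʳ-+ ε ½ ½)) (ℚₚ.*-identityˡ ε)

  open CommutativeSemigroupProperties
    (CommutativeMonoid.commutativeSemigroup ℚₚ.+-0-commutativeMonoid)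
    using (interchange)

fromℚ : ℚ → ℝ
fromℚ q = mkℝ (λ _ → q) (λ ε 0<ε → 0 , λ _ _ _ _ → p≤p+ε q 0<ε)

0ℝ : ℝ
0ℝ = fromℚ 0ℚ

_+_ : ℝ → ℝ → ℝ
x + y = mkℝ (λ n → seq x n ℚ.+ seq y n) isCauchy
  where
  isCauchy : IsCauchy (λ n → seq x n ℚ.+ seq y n)
  isCauchy ε 0<ε
    with M , p ← cauchy x (½ ℚ.* ε) (half-pos ε 0<ε)
       | N , q ← cauchy y (½ ℚ.* ε) (half-pos ε 0<ε)
    = M ℕ.⊔ N , λ m n m≥ n≥ →
      subst (seq x m ℚ.+ seq y m ℚ.≤_)
        (trans (interchange (seq x n) _ (seq y n) _)
               (cong (seq x n ℚ.+ seq y n ℚ.+_) (half+half ε)))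
        (ℚₚ.+-mono-≤
          (p m n (ℕₚ.m⊔n≤o⇒m≤o M N m≥) (ℕₚ.m⊔n≤o⇒m≤o M N n≥))
          (q m n (ℕₚ.m⊔n≤o⇒n≤o M N m≥) (ℕₚ.m⊔n≤o⇒n≤o M N n≥)))

_⊔_ : ℝ → ℝ → ℝ
x ⊔ y = mkℝ (λ n → seq x n ℚ.⊔ seq y n) isCauchy
  where
  isCauchy : IsCauchy (λ n → seq x n ℚ.⊔ seq y n)
  isCauchy ε 0<ε with M , p ← cauchy x ε 0<ε | N , q ← cauchy y ε 0<ε
    = M ℕ.⊔ N , λ m n m≥ n≥ → ℚₚ.⊔-lub
      (ℚₚ.≤-trans
        (p m n (ℕₚ.m⊔n≤o⇒m≤o M N m≥) (ℕₚ.m⊔n≤o⇒m≤o M N n≥))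
        (ℚₚ.+-monoˡ-≤ ε (ℚₚ.p≤p⊔q (seq x n) (seq y n))))
      (ℚₚ.≤-trans
        (q m n (ℕₚ.m⊔n≤o⇒n≤o M N m≥) (ℕₚ.m⊔n≤o⇒n≤o M N n≥))
        (ℚₚ.+-monoˡ-≤ ε (ℚₚ.p≤q⊔p (seq x n) (seq y n))))

∑ : ∀ {n} → Vector ℝ n → ℝ
∑ = foldr _+_ 0ℝ

max : ∀ {k} → Vector ℝ (suc k) → ℝ
max xs = foldr _⊔_ (head xs) (tail xs)

SetFunction : ℕ → Set
SetFunction n = Subset n → ℝ

IsAdditive : ∀ {n} → SetFunction n → Set
IsAdditive g = ∀ X → g X ≃ ∑ (λ v → if lookup X v then g ⁅ v ⁆ else 0ℝ)

IsXOS : ∀ {n} → SetFunction n → Set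
IsXOS {n} f =
  ∃[ k ] Σ[ fs ∈ Vector (SetFunction n) (suc k) ]
    (∀ i → IsAdditive (fs i)) × (∀ X → f X ≃ max (λ i → fs i X))

OrderEquivalent : ∀ {n} → SetFunction n → SetFunction n → Set
OrderEquivalent f g = ∀ X Y → f X ≤ f Y ⇔ g X ≤ g Y

OrderDifferent : ∀ {n} → SetFunction n → SetFunction n → Set
OrderDifferent f g = ¬ OrderEquivalent f g

-- There are exactly N order-equivalence classes of XOS functions on Fin n:
-- N pairwise order-different XOS functions represent all of them.  That every
-- XOS function has a representative is the classical "there exists" (¬ ¬ ∃),
-- as the order of the reals is not decidable.
NumberOfOrderDifferentXOS : ℕ → ℕ → Set
NumberOfOrderDifferentXOS n N =
  Σ[ rep ∈ (Fin N → SetFunction n) ]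
    (∀ i → IsXOS (rep i)) ×
    (∀ i j → i ≢ j → OrderDifferent (rep i) (rep j)) ×
    (∀ f → IsXOS f → ¬ ¬ (∃[ i ] OrderEquivalent f (rep i)))

infix 4 _∈Θ_

_∈Θ_ : (ℕ → ℕ) → (ℕ → ℕ) → Set
f ∈Θ g =
  ∃[ c ] ∃[ C ] 0ℚ ℚ.< c × 0ℚ ℚ.< C ×
    ∃[ n₀ ] (∀ n → n₀ ℕ.≤ n →
      c ℚ.* (+ g n ℚ./ 1) ℚ.≤ + f n ℚ./ 1 ×
      + f n ℚ./ 1 ℚ.≤ C ℚ.* (+ g n ℚ./ 1))

-- Upper bound: an order-equivalence class is determined by the set of pairs
-- (X , Y) with f X ≤ f Y, so there are at most 2 ^ 2 ^ (n + n) of them.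
--
-- Lower bound: on a ground set of m + 1 elements, of which the first is
-- special, every x ⊆ [m] has an additive function g with
-- g ({special} ∪ y) = 1 - ∣ x △ y ∣.  For a family S of subsets of [m], let f
-- be the maximum of 0 and of the g belonging to the members x of S.  Then
-- f ({special} ∪ y) is 1 if y ∈ S and 0 otherwise, so that comparing it with
-- f ∅ = 0 recovers S from the order of f.
module Submission where

open import Defs using
  ( NumberOfOrderDifferentXOS; _∈Θ_; OrderEquivalent; OrderDifferent; IsXOS
  ; IsAdditive; SetFunction; ℝ; seq; 0ℝ; fromℚ; ∑; max; _≃_ )
open import Data.Nat.Base as ℕ using (ℕ; zero; suc; pred; _^_; _≤_; s≤s)
open import Data.Product.Base using (∃-syntax; _×_)
open import Function.Base using (id)
open import Relation.Nullary using (¬_)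

open import Data.Bool.Base using (Bool; true; false; if_then_else_)
open import Data.Fin.Base using (Fin; zero; suc)
import Data.Fin.Properties as Fin
open import Data.Fin.Subset using (Subset; ⁅_⁆; ⊥)
import Data.Integer.Base as ℤ
import Data.Integer.Properties as ℤ
import Data.Nat.Properties as ℕ
open import Data.Product.Base using (Σ-syntax; proj₁; proj₂; uncurry; _,_)
open import Data.Product.Function.NonDependent.Propositional using (_×-↔_)
open import Data.Rational.Base as ℚ using (ℚ; 0ℚ; 1ℚ; ½; _+_; _-_; -_)
import Data.Rational.Properties as ℚ
open import Data.Rational.Unnormalised.Base as ℚᵘ using (mkℚᵘ)
import Data.Rational.Unnormalised.Properties as ℚᵘ
open import Data.Vec.Base as Vec using ([]; _∷_; _++_; tabulate; take; drop)
open import Data.Vec.Functional as Vector using (Vector; foldr; tail)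
import Data.Vec.Properties as Vec
open import Effect.Monad using (RawMonad)
open import Function.Base using (_∘_; const; _$_)
open import Function.Bundles using (_↔_; mk↔ₛ′; _⇔_; mk⇔; Inverse; module Equivalence)
open import Function.Construct.Composition using (_↔-∘_; _⇔-∘_)
open import Function.Construct.Symmetry using (⇔-sym)
open import Level using (0ℓ)
open import Relation.Binary.PropositionalEquality
open import Relation.Nullary using (Dec; yes; no; does; contradiction)
open import Relation.Nullary.Decidable
  using (decidable-stable; ¬¬-excluded-middle; toWitness)
open import Relation.Nullary.Negation using (¬¬-Monad; ¬¬-map)

-- Counting under double negation

subset↔ : ∀ k → Fin (2 ^ k) ↔ Subset k
subset↔ zero    = mk↔ₛ′ (const []) (const zero) (λ { [] → refl }) (λ { zero → refl })
subset↔ (suc k) = ∷↔ ↔-∘ ((Fin.2↔Bool ×-↔ subset↔ k) ↔-∘ Fin.*↔×)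
  where
  ∷↔ : (Bool × Subset k) ↔ Subset (suc k)
  ∷↔ = mk↔ₛ′ (uncurry _∷_) (λ { (b ∷ X) → b , X })
    (λ { (b ∷ X) → refl }) (λ _ → refl)

decode : ∀ k → Fin (2 ^ k) → Subset k
decode k = Inverse.to (subset↔ k)

encode : ∀ k → Subset k → Fin (2 ^ k)
encode k = Inverse.from (subset↔ k)

decode-encode : ∀ k (X : Subset k) → decode k (encode k X) ≡ X
decode-encode k = Inverse.strictlyInverseˡ (subset↔ k)

encode-decode : ∀ k (i : Fin (2 ^ k)) → encode k (decode k i) ≡ i
encode-decode k = Inverse.strictlyInverseʳ (subset↔ k)

decode-injective : ∀ k {i j} → decode k i ≡ decode k j → i ≡ j
decode-injective k {i} {j} eq =
  trans (sym (encode-decode k i)) (trans (cong (encode k) eq) (encode-decode k j))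

encode-injective : ∀ k {X Y} → encode k X ≡ encode k Y → X ≡ Y
encode-injective k {X} {Y} eq =
  trans (sym (decode-encode k X)) (trans (cong (decode k) eq) (decode-encode k Y))

-- Finitely many classical facts may be assumed all at once, by induction on the index set. This
-- allows case distinctions on the order of the reals as long as the goal is stable.
¬¬-sequence : ∀ {N} {P : Fin N → Set} → (∀ i → ¬ ¬ P i) → ¬ ¬ (∀ i → P i)
¬¬-sequence = Fin.sequence (RawMonad.rawApplicative (¬¬-Monad {0ℓ}))

does-≡⇒⇔ : {P Q : Set} (p? : Dec P) (q? : Dec Q) → does p? ≡ does q? → P ⇔ Q
does-≡⇒⇔ (yes p) (yes q) _ = mk⇔ (const q) (const p)
does-≡⇒⇔ (no ¬p) (no ¬q) _ =
  mk⇔ (λ p → contradiction p ¬p) (λ q → contradiction q ¬q)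

-- The goal is decidable, hence stable, so all `P i x` may be assumed decided. Each predicate then
-- has a truth table in `Subset k`, and equal tables would make two predicates equivalent.
different-predicates-≤ : ∀ {N k} (P : Fin N → Fin k → Set) →
  (∀ i j → i ≢ j → ¬ (∀ x → P i x ⇔ P j x)) → N ≤ 2 ^ k
different-predicates-≤ {N} {k} P different = decidable-stable (N ℕ.≤? 2 ^ k) $
  ¬¬-map bound (¬¬-sequence (λ i → ¬¬-sequence (λ x → ¬¬-excluded-middle)))
  where
  bound : (∀ i x → Dec (P i x)) → N ≤ 2 ^ k
  bound P? = Fin.injective⇒≤ {f = encode k ∘ table} λ {i} {j} eq →
    decidable-stable (i Fin.≟ j) λ i≢j → different i j i≢j λ x →
      does-≡⇒⇔ (P? i x) (P? j x) (begin
        does (P? i x)           ≡⟨ Vec.lookup∘tabulate (does ∘ P? i) x ⟨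
        Vec.lookup (table i) x  ≡⟨ cong (λ X → Vec.lookup X x) (encode-injective k eq) ⟩
        Vec.lookup (table j) x  ≡⟨ Vec.lookup∘tabulate (does ∘ P? j) x ⟩
        does (P? j x)           ∎)
    where
    open ≡-Reasoning
    table : Fin N → Subset k
    table i = tabulate (does ∘ P? i)

-- The upper bound

OrderEquivalent-sym : ∀ {n} {f g : SetFunction n} →
  OrderEquivalent f g → OrderEquivalent g f
OrderEquivalent-sym f∼g X Y = ⇔-sym (f∼g X Y)

OrderEquivalent-trans : ∀ {n} {f g h : SetFunction n} →
  OrderEquivalent f g → OrderEquivalent g h → OrderEquivalent f h
OrderEquivalent-trans f∼g g∼h X Y = g∼h X Y ⇔-∘ f∼g X Y

PairwiseOrderDifferent : ∀ {n N} → Vector (SetFunction n) N → Set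
PairwiseOrderDifferent fs = ∀ i j → i ≢ j → OrderDifferent (fs i) (fs j)

-- The order of a function is a predicate on pairs of subsets. Concatenation turns a pair into one
-- subset of `n ℕ.+ n` elements, so there are `2 ^ (n ℕ.+ n)` points to test.
pairwiseOrderDifferent-≤ : ∀ {n N} (fs : Vector (SetFunction n) N) →
  PairwiseOrderDifferent fs → N ≤ 2 ^ (2 ^ (n ℕ.+ n))
pairwiseOrderDifferent-≤ {n} {N} fs different =
  different-predicates-≤ (λ i → Below (fs i) ∘ decode (n ℕ.+ n)) λ i j i≢j same →
    different i j i≢j λ X Y →
      -- `same` speaks of the two halves of the decoded pair; injectivity of `++` identifies them
      -- with `X` and `Y`.
      subst₂ (λ X′ Y′ → fs i X′ Defs.≤ fs i Y′ ⇔ fs j X′ Defs.≤ fs j Y′)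
        (Vec.++-injectiveˡ _ X (split X Y))
        (Vec.++-injectiveʳ (take n (pair X Y)) X (split X Y))
        (same (encode (n ℕ.+ n) (X ++ Y)))
  where
  Below : SetFunction n → Subset (n ℕ.+ n) → Set
  Below f Z = f (take n Z) Defs.≤ f (drop n Z)

  pair : Subset n → Subset n → Subset (n ℕ.+ n)
  pair X Y = decode (n ℕ.+ n) (encode (n ℕ.+ n) (X ++ Y))

  split : ∀ X Y → take n (pair X Y) ++ drop n (pair X Y) ≡ X ++ Y
  split X Y = trans (Vec.take++drop≡id n (pair X Y)) (decode-encode (n ℕ.+ n) (X ++ Y))

-- Classical existence of the number of classes, and its comparison with families.

OrderDifferentXOS : ℕ → ℕ → Set
OrderDifferentXOS n N = Σ[ fs ∈ Vector (SetFunction n) N ]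
  (∀ i → IsXOS (fs i)) × PairwiseOrderDifferent fs

extend : ∀ {n N} ((fs , _) : OrderDifferentXOS n N) f → IsXOS f →
  ¬ (∃[ i ] OrderEquivalent f (fs i)) → OrderDifferentXOS n (suc N)
extend (fs , xos , different) f f-xos new = f Vector.∷ fs , xos′ , different′
  where
  xos′ : ∀ i → IsXOS ((f Vector.∷ fs) i)
  xos′ zero    = f-xos
  xos′ (suc i) = xos i

  different′ : PairwiseOrderDifferent (f Vector.∷ fs)
  different′ zero    zero    0≢0 _ = 0≢0 refl
  different′ zero    (suc j) _     = λ eq → new (j , eq)
  different′ (suc i) zero    _     = λ eq → new (i , OrderEquivalent-sym {f = fs i} {g = f} eq)
  different′ (suc i) (suc j) i≢j   = different i j (i≢j ∘ cong suc)

-- As long as a family does not represent all XOS functions it can be extended,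
-- but its size is bounded.
number-exists : ∀ n → ¬ ¬ (∃[ N ] NumberOfOrderDifferentXOS n N)
-- One more than the upper bound, so a family of this size is absurd.
number-exists n none = arbitrarily-large (suc (2 ^ (2 ^ (n ℕ.+ n)))) λ (fs , _ , different) →
  ℕ.<-irrefl refl (pairwiseOrderDifferent-≤ fs different)
  where
  arbitrarily-large : ∀ N → ¬ ¬ OrderDifferentXOS n N
  arbitrarily-large zero    ¬ds = ¬ds ((λ ()) , (λ ()) , λ ())
  arbitrarily-large (suc N) ¬ds = arbitrarily-large N λ ds@(fs , xos , different) →
    -- Completeness asks only for a double negation, so it suffices to refute that some `f` is new;
    -- a new `f` would give the family of size `suc N` that `¬ds` excludes.
    none (N , fs , xos , different , λ f f-xos new → ¬ds (extend ds f f-xos new))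

-- Sending each member to its representative is injective, since two members with a common
-- representative would be order-equivalent. A simultaneous choice of representatives exists only
-- classically, which suffices for a decidable goal.
family-≤-number : ∀ {n M N} (fs : Vector (SetFunction n) M) → (∀ i → IsXOS (fs i)) →
  PairwiseOrderDifferent fs → NumberOfOrderDifferentXOS n N → M ≤ N
family-≤-number {n} {M} {N} fs xos different (rep , _ , _ , complete) =
  decidable-stable (M ℕ.≤? N) $
  ¬¬-map bound (¬¬-sequence (λ i → complete (fs i) (xos i)))
  where
  bound : (∀ i → ∃[ j ] OrderEquivalent (fs i) (rep j)) → M ≤ N
  bound represent = Fin.injective⇒≤ {f = proj₁ ∘ represent} λ {i} {j} eq →
    decidable-stable (i Fin.≟ j) λ i≢j → different i j i≢j
      (OrderEquivalent-trans {f = fs i} {g = rep (proj₁ (represent i))} {h = fs j}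
        (proj₂ (represent i))
        (OrderEquivalent-sym {f = fs j} {g = rep (proj₁ (represent i))}
          (subst (λ k → OrderEquivalent (fs j) (rep k)) (sym eq) (proj₂ (represent j)))))

-- Maxima of rational additive functions

p≤p+q : ∀ p {q} → 0ℚ ℚ.≤ q → p ℚ.≤ p + q
p≤p+q p {q} 0≤q = subst (ℚ._≤ p + q) (ℚ.+-identityʳ p) (ℚ.+-monoʳ-≤ p 0≤q)

≗⇒≃ : ∀ {x y : ℝ} → seq x ≗ seq y → x ≃ y
≗⇒≃ x≗y =
    (λ ε 0<ε → 0 , λ k _ →
      ℚ.≤-trans (ℚ.≤-reflexive (x≗y k)) (p≤p+q _ (ℚ.<⇒≤ 0<ε)))
  , (λ ε 0<ε → 0 , λ k _ →
      ℚ.≤-trans (ℚ.≤-reflexive (sym (x≗y k))) (p≤p+q _ (ℚ.<⇒≤ 0<ε)))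

weight : ∀ {n} → Vector ℚ n → Subset n → ℚ
weight w X = foldr _+_ 0ℚ (λ v → if Vec.lookup X v then w v else 0ℚ)

-- Constant sequences suffice for the construction, so its estimates can be made in ℚ, index by
-- index.
additive : ∀ {n} → Vector ℚ n → SetFunction n
additive w X = fromℚ (weight w X)

weight-⊥ : ∀ {n} (w : Vector ℚ n) → weight w ⊥ ≡ 0ℚ
weight-⊥ {zero}  w = refl
weight-⊥ {suc n} w = trans (ℚ.+-identityˡ _) (weight-⊥ (tail w))

weight-⁅⁆ : ∀ {n} (w : Vector ℚ n) v → weight w ⁅ v ⁆ ≡ w v
weight-⁅⁆ w zero    = trans (cong (w zero +_) (weight-⊥ (tail w))) (ℚ.+-identityʳ _)
weight-⁅⁆ w (suc v) = trans (ℚ.+-identityˡ _) (weight-⁅⁆ (tail w) v)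

foldr-cong : ∀ {n} {xs ys : Vector ℚ n} → xs ≗ ys → foldr _+_ 0ℚ xs ≡ foldr _+_ 0ℚ ys
foldr-cong {zero}  _     = refl
foldr-cong {suc n} xs≗ys = cong₂ _+_ (xs≗ys zero) (foldr-cong (xs≗ys ∘ suc))

seq-∑ : ∀ {n} (xs : Vector ℝ n) k → seq (∑ xs) k ≡ foldr _+_ 0ℚ (λ v → seq (xs v) k)
seq-∑ {zero}  xs k = refl
seq-∑ {suc n} xs k = cong (seq (xs zero) k +_) (seq-∑ (tail xs) k)

additive-isAdditive : ∀ {n} (w : Vector ℚ n) → IsAdditive (additive w)
additive-isAdditive w X =
  ≗⇒≃ {additive w X} {∑ terms} λ k → sym (trans (seq-∑ terms k) (foldr-cong (term k)))
  where
  terms : Vector ℝ _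
  terms v = if Vec.lookup X v then additive w ⁅ v ⁆ else 0ℝ

  term : ∀ k v → seq (terms v) k ≡ (if Vec.lookup X v then w v else 0ℚ)
  term k v with Vec.lookup X v
  ... | true  = weight-⁅⁆ w v
  ... | false = refl

max-weight : ∀ {n k} → Vector (Vector ℚ n) (suc k) → SetFunction n
max-weight ws X = max (λ i → additive (ws i) X)

max-weight-isXOS : ∀ {n k} (ws : Vector (Vector ℚ n) (suc k)) → IsXOS (max-weight ws)
max-weight-isXOS ws =
  _ , additive ∘ ws , additive-isAdditive ∘ ws ,
  λ X → ≗⇒≃ {max-weight ws X} {max-weight ws X} λ _ → refl

-- `max` folds the tail starting from the head, so the start value and the folded entries are
-- bounded separately.
foldr-⊔-upper : ∀ {k} x (xs : Vector ℝ k) l → seq x l ℚ.≤ seq (foldr Defs._⊔_ x xs) l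
foldr-⊔-upper {zero}  x xs l = ℚ.≤-refl
foldr-⊔-upper {suc k} x xs l =
  ℚ.≤-trans (foldr-⊔-upper x (tail xs) l) (ℚ.p≤q⊔p (seq (xs zero) l) _)

foldr-⊔-upper-∈ : ∀ {k} x (xs : Vector ℝ k) i l →
  seq (xs i) l ℚ.≤ seq (foldr Defs._⊔_ x xs) l
foldr-⊔-upper-∈ x xs zero    l = ℚ.p≤p⊔q _ _
foldr-⊔-upper-∈ x xs (suc i) l =
  ℚ.≤-trans (foldr-⊔-upper-∈ x (tail xs) i l) (ℚ.p≤q⊔p (seq (xs zero) l) _)

max-upper : ∀ {k} (xs : Vector ℝ (suc k)) i l → seq (xs i) l ℚ.≤ seq (max xs) l
max-upper xs zero    = foldr-⊔-upper (xs zero) (tail xs)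
max-upper xs (suc i) = foldr-⊔-upper-∈ (xs zero) (tail xs) i

foldr-⊔-lub : ∀ {k} x (xs : Vector ℝ k) l {b} → seq x l ℚ.≤ b →
  (∀ i → seq (xs i) l ℚ.≤ b) → seq (foldr Defs._⊔_ x xs) l ℚ.≤ b
foldr-⊔-lub {zero}  x xs l x≤b xs≤b = x≤b
foldr-⊔-lub {suc k} x xs l x≤b xs≤b =
  ℚ.⊔-lub (xs≤b zero) (foldr-⊔-lub x (tail xs) l x≤b (xs≤b ∘ suc))

max-lub : ∀ {k} (xs : Vector ℝ (suc k)) l {b} →
  (∀ i → seq (xs i) l ℚ.≤ b) → seq (max xs) l ℚ.≤ b
max-lub xs l xs≤b = foldr-⊔-lub (xs zero) (tail xs) l (xs≤b zero) (xs≤b ∘ suc)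

-- The lower bound

signs : ∀ {m} → Subset m → Vector ℚ m
signs x i = if Vec.lookup x i then 1ℚ else - 1ℚ

-- The left side is ∣ y ∩ x ∣ - ∣ y ∖ x ∣ and the right side is ∣ x ∣; they differ by ∣ x △ y ∣.
signs-max : ∀ {m} (x y : Subset m) → weight (signs x) y ℚ.≤ weight (signs x) x
signs-max []          []          = ℚ.≤-refl
signs-max (true  ∷ x) (true  ∷ y) = ℚ.+-monoʳ-≤ 1ℚ (signs-max x y)
signs-max (true  ∷ x) (false ∷ y) = ℚ.+-mono-≤ (toWitness {a? = 0ℚ ℚ.≤? 1ℚ} _) (signs-max x y)
signs-max (false ∷ x) (true  ∷ y) = ℚ.+-mono-≤ (toWitness {a? = - 1ℚ ℚ.≤? 0ℚ} _) (signs-max x y)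
signs-max (false ∷ x) (false ∷ y) = ℚ.+-monoʳ-≤ 0ℚ (signs-max x y)

-- Here ∣ x △ y ∣ is at least 1: the first coordinate of disagreement costs 1, and `signs-max`
-- handles the coordinates after it.
signs-gap : ∀ {m} {x y : Subset m} → x ≢ y →
  1ℚ + weight (signs x) y ℚ.≤ weight (signs x) x
signs-gap {x = []} {[]} x≢y = contradiction refl x≢y
signs-gap {x = b ∷ x} {c ∷ y} x≢y = go b c x≢y
  where
  -- Equal heads contribute the same `p` to both sides.
  shift : ∀ p q r → 1ℚ + q ℚ.≤ r → 1ℚ + (p + q) ℚ.≤ p + r
  shift p q r le = begin
    1ℚ + (p + q)  ≡⟨ ℚ.+-assoc 1ℚ p q ⟨
    (1ℚ + p) + q  ≡⟨ cong (_+ q) (ℚ.+-comm 1ℚ p) ⟩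
    (p + 1ℚ) + q  ≡⟨ ℚ.+-assoc p 1ℚ q ⟩
    p + (1ℚ + q)  ≤⟨ ℚ.+-monoʳ-≤ p le ⟩
    p + r         ∎
    where open ℚ.≤-Reasoning

  go : ∀ b c → b ∷ x ≢ c ∷ y →
    1ℚ + weight (signs (b ∷ x)) (c ∷ y) ℚ.≤ weight (signs (b ∷ x)) (b ∷ x)
  go true  true  x≢y = shift 1ℚ (weight (signs x) y) (weight (signs x) x)
    (signs-gap (x≢y ∘ cong (true ∷_)))
  go false false x≢y = shift 0ℚ (weight (signs x) y) (weight (signs x) x)
    (signs-gap (x≢y ∘ cong (false ∷_)))
  go true  false x≢y =
    ℚ.+-monoʳ-≤ 1ℚ (ℚ.≤-trans (ℚ.≤-reflexive (ℚ.+-identityˡ _)) (signs-max x y))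
  go false true  x≢y = ℚ.≤-trans
    (ℚ.≤-reflexive (sym (ℚ.+-assoc 1ℚ (- 1ℚ) (weight (signs x) y))))
    (ℚ.+-monoʳ-≤ 0ℚ (signs-max x y))

-- The constant term makes the weight of true ∷ y equal to 1 - ∣ x △ y ∣.
detector : ∀ {m} → Subset m → Vector ℚ (suc m)
detector x = 1ℚ - weight (signs x) x Vector.∷ signs x

detector-self : ∀ {m} (x : Subset m) → weight (detector x) (true ∷ x) ≡ 1ℚ
detector-self x = begin
  1ℚ - s + s      ≡⟨ ℚ.+-assoc 1ℚ (- s) s ⟩
  1ℚ + (- s + s)  ≡⟨ cong (1ℚ +_) (ℚ.+-inverseˡ s) ⟩
  1ℚ              ∎
  where
  open ≡-Reasoning
  s = weight (signs x) x

-- `signs-gap` says that `t` is at most `s` minus 1. With `detector-self`, the maximum with 0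
-- becomes the indicator of `x`.
detector-other : ∀ {m} {x y : Subset m} → x ≢ y → weight (detector x) (true ∷ y) ℚ.≤ 0ℚ
detector-other {x = x} {y} x≢y = begin
  1ℚ - s + t      ≡⟨ cong (_+ t) (ℚ.+-comm 1ℚ (- s)) ⟩
  - s + 1ℚ + t    ≡⟨ ℚ.+-assoc (- s) 1ℚ t ⟩
  - s + (1ℚ + t)  ≤⟨ ℚ.+-monoʳ-≤ (- s) (signs-gap x≢y) ⟩
  - s + s         ≡⟨ ℚ.+-inverseˡ s ⟩
  0ℚ              ∎
  where
  open ℚ.≤-Reasoning
  s = weight (signs x) x
  t = weight (signs x) y

weight-0 : ∀ {n} (X : Subset n) → weight (const 0ℚ) X ≡ 0ℚ
weight-0 []          = refl
weight-0 (true  ∷ X) = trans (ℚ.+-identityˡ _) (weight-0 X)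
weight-0 (false ∷ X) = trans (ℚ.+-identityˡ _) (weight-0 X)

-- XOS functions that encode families of sets.

module _ (m : ℕ) where

  -- A family of subsets of [m] is a subset `S` of their numbers under `decode m`. Numbers outside
  -- `S` get the zero function, so that the number of components is the same for every `S`.
  components : Subset (2 ^ m) → Vector (Vector ℚ (suc m)) (suc (2 ^ m))
  components S = const 0ℚ Vector.∷
    λ i → if Vec.lookup S i then detector (decode m i) else const 0ℚ

  family : Subset (2 ^ m) → SetFunction (suc m)
  family S = max-weight (components S)

  query : Fin (2 ^ m) → Subset (suc m)
  query i = true ∷ decode m i

  family-⊥ : ∀ S l → seq (family S ⊥) l ≡ 0ℚ
  family-⊥ S l = ℚ.≤-antisym
    (max-lub values l λ i → ℚ.≤-reflexive (weight-⊥ (components S i)))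
    (subst (ℚ._≤ seq (family S ⊥) l) (weight-⊥ (components S zero)) (max-upper values zero l))
    where
    values : Vector ℝ (suc (2 ^ m))
    values i = additive (components S i) ⊥

  family-∈ : ∀ S i l → Vec.lookup S i ≡ true → 1ℚ ℚ.≤ seq (family S (query i)) l
  family-∈ S i l i∈S = begin
    1ℚ                                        ≡⟨ detector-self (decode m i) ⟨
    -- At `Vec.lookup S i`, `value` is the weight of component `suc i`.
    weight (detector (decode m i)) (query i)  ≡⟨ cong value i∈S ⟨
    value (Vec.lookup S i)
      ≤⟨ max-upper (λ j → additive (components S j) (query i)) (suc i) l ⟩
    seq (family S (query i)) l                ∎
    where
    open ℚ.≤-Reasoning
    value : Bool → ℚ
    value b = weight (if b then detector (decode m i) else const 0ℚ) (query i)

  family-∉ : ∀ S i l → Vec.lookup S i ≡ false → seq (family S (query i)) l ℚ.≤ 0ℚ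
  family-∉ S i l i∉S = max-lub (λ j → additive (components S j) (query i)) l component-≤0
    where
    component-≤0 : ∀ j → weight (components S j) (query i) ℚ.≤ 0ℚ
    component-≤0 zero = ℚ.≤-reflexive (weight-0 (query i))
    component-≤0 (suc j) with Vec.lookup S j in j∈S
    ... | false = ℚ.≤-reflexive (weight-0 (query i))
    -- If `j` and `i` decoded to the same set, `j ∈ S` would contradict `i ∉ S`.
    ... | true  = detector-other λ eq → contradiction
      (trans (sym j∈S) (trans (cong (Vec.lookup S) (decode-injective m eq)) i∉S)) λ ()

  ∈⇒≰ : ∀ S i → Vec.lookup S i ≡ true → ¬ (family S (query i) Defs.≤ family S ⊥)
  -- Any tolerance strictly between 0 and 1 separates the values 1 and 0.
  ∈⇒≰ S i i∈S le with N , below ← le ½ (toWitness {a? = 0ℚ ℚ.<? ½} _) =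
    ℚ.<-irrefl refl (begin-strict
      0ℚ + ½                      <⟨ toWitness {a? = (0ℚ + ½) ℚ.<? 1ℚ} _ ⟩
      1ℚ                          ≤⟨ family-∈ S i N i∈S ⟩
      seq (family S (query i)) N  ≤⟨ below N ℕ.≤-refl ⟩
      seq (family S ⊥) N + ½      ≡⟨ cong (_+ ½) (family-⊥ S N) ⟩
      0ℚ + ½                      ∎)
    where open ℚ.≤-Reasoning

  ∉⇒≤ : ∀ S i → Vec.lookup S i ≡ false → family S (query i) Defs.≤ family S ⊥
  ∉⇒≤ S i i∉S ε 0<ε = 0 , λ k _ → begin
    seq (family S (query i)) k  ≤⟨ family-∉ S i k i∉S ⟩
    0ℚ                          ≡⟨ family-⊥ S k ⟨
    seq (family S ⊥) k          ≤⟨ p≤p+q _ (ℚ.<⇒≤ 0<ε) ⟩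
    seq (family S ⊥) k + ε      ∎
    where open ℚ.≤-Reasoning

  -- Membership of `i` is the failure of one comparison, `query i` against `⊥`, and order
  -- equivalence preserves comparisons.
  family-injective : ∀ S S′ → OrderEquivalent (family S) (family S′) → S ≡ S′
  family-injective S S′ S∼S′ = begin
    S                         ≡⟨ Vec.tabulate∘lookup S ⟨
    tabulate (Vec.lookup S)   ≡⟨ Vec.tabulate-cong same ⟩
    tabulate (Vec.lookup S′)  ≡⟨ Vec.tabulate∘lookup S′ ⟩
    S′                        ∎
    where
    open ≡-Reasoning
    same : Vec.lookup S ≗ Vec.lookup S′
    same i with Vec.lookup S i in eq | Vec.lookup S′ i in eq′
    ... | true  | true  = refl
    ... | false | false = refl
    ... | true  | false =
      contradiction (Equivalence.from (S∼S′ (query i) ⊥) (∉⇒≤ S′ i eq′)) (∈⇒≰ S i eq)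
    ... | false | true  =
      contradiction (Equivalence.to (S∼S′ (query i) ⊥) (∉⇒≤ S i eq)) (∈⇒≰ S′ i eq′)

  number-≥ : ∀ {N} → NumberOfOrderDifferentXOS (suc m) N → 2 ^ (2 ^ m) ≤ N
  -- This `decode` numbers the families; the one inside `components` numbers their members.
  number-≥ = family-≤-number (family ∘ decode (2 ^ m))
    (λ s → max-weight-isXOS (components (decode (2 ^ m) s)))
    λ s s′ s≢s′ eq → s≢s′ (decode-injective (2 ^ m)
      (family-injective (decode (2 ^ m) s) (decode (2 ^ m) s′) eq))

-- Linear growth

ι : ℕ → ℚ
ι k = ℤ.+ k ℚ./ 1

-- `ℚ./` normalises by a gcd that does not reduce for a variable `k`; unnormalised rationals avoid
-- this.
toℚᵘ-ι : ∀ k → ℚ.toℚᵘ (ι k) ℚᵘ.≃ mkℚᵘ (ℤ.+ k) 0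
toℚᵘ-ι k = ℚ.toℚᵘ-fromℚᵘ (mkℚᵘ (ℤ.+ k) 0)

ι-mono-≤ : ∀ {j k} → j ≤ k → ι j ℚ.≤ ι k
ι-mono-≤ {j} {k} j≤k = ℚ.toℚᵘ-cancel-≤ (begin
  ℚ.toℚᵘ (ι j)      ≃⟨ toℚᵘ-ι j ⟩
  mkℚᵘ (ℤ.+ j) 0    ≤⟨ ℚᵘ.*≤* (ℤ.*-monoʳ-≤-nonNeg (ℤ.+ 1) (ℤ.+≤+ j≤k)) ⟩
  mkℚᵘ (ℤ.+ k) 0    ≃⟨ toℚᵘ-ι k ⟨
  ℚ.toℚᵘ (ι k)      ∎)
  where open ℚᵘ.≤-Reasoning

ι-+ : ∀ j k → ι (j ℕ.+ k) ≡ ι j + ι k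
ι-+ j k = ℚ.toℚᵘ-injective (begin
  ℚ.toℚᵘ (ι (j ℕ.+ k))                ≈⟨ toℚᵘ-ι (j ℕ.+ k) ⟩
  mkℚᵘ (ℤ.+ (j ℕ.+ k)) 0
    ≈⟨ ℚᵘ.*≡* (cong (ℤ._* ℤ.+ 1)
         (cong₂ ℤ._+_ (ℤ.*-identityʳ (ℤ.+ j)) (ℤ.*-identityʳ (ℤ.+ k)))) ⟨
  mkℚᵘ (ℤ.+ j) 0 ℚᵘ.+ mkℚᵘ (ℤ.+ k) 0  ≈⟨ ℚᵘ.+-cong (toℚᵘ-ι j) (toℚᵘ-ι k) ⟨
  ℚ.toℚᵘ (ι j) ℚᵘ.+ ℚ.toℚᵘ (ι k)      ≈⟨ ℚ.toℚᵘ-homo-+ (ι j) (ι k) ⟨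
  ℚ.toℚᵘ (ι j + ι k)                  ∎)
  where open import Relation.Binary.Reasoning.Setoid ℚᵘ.≃-setoid

double-∈Θ : (λ n → n ℕ.+ n) ∈Θ id
double-∈Θ = 1ℚ , 1ℚ + 1ℚ , toWitness {a? = 0ℚ ℚ.<? 1ℚ} _ ,
  toWitness {a? = 0ℚ ℚ.<? (1ℚ + 1ℚ)} _ , 0 , λ n _ →
    subst (ℚ._≤ ι (n ℕ.+ n)) (sym (ℚ.*-identityˡ (ι n))) (ι-mono-≤ (ℕ.m≤m+n n n)) ,
    ℚ.≤-reflexive (begin
      ι (n ℕ.+ n)                      ≡⟨ ι-+ n n ⟩
      ι n + ι n                        ≡⟨ cong₂ _+_ (ℚ.*-identityˡ (ι n)) (ℚ.*-identityˡ (ι n)) ⟨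
      1ℚ ℚ.* ι n + 1ℚ ℚ.* ι n          ≡⟨ ℚ.*-distribʳ-+ (ι n) 1ℚ 1ℚ ⟨
      (1ℚ + 1ℚ) ℚ.* ι n                ∎)
  where open ≡-Reasoning

pred-∈Θ : pred ∈Θ id
-- With `n` equal to `suc p`, the constant ½ requires `suc p ≤ p ℕ.+ p`, which holds from `p` equal
-- to 1 on; hence the threshold 2.
pred-∈Θ = ½ , 1ℚ , toWitness {a? = 0ℚ ℚ.<? ½} _ , toWitness {a? = 0ℚ ℚ.<? 1ℚ} _ , 2 , bounds
  where
  open ℚ.≤-Reasoning
  bounds : ∀ n → 2 ≤ n → ½ ℚ.* ι n ℚ.≤ ι (pred n) × ι (pred n) ℚ.≤ 1ℚ ℚ.* ι n
  bounds n@(suc p) (s≤s 1≤p) =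
    (begin
      ½ ℚ.* ι n                ≤⟨ ℚ.*-monoˡ-≤-nonNeg ½ (ι-mono-≤ (ℕ.+-monoˡ-≤ p 1≤p)) ⟩
      ½ ℚ.* ι (p ℕ.+ p)        ≡⟨ cong (½ ℚ.*_) (ι-+ p p) ⟩
      ½ ℚ.* (ι p + ι p)        ≡⟨ ℚ.*-distribˡ-+ ½ (ι p) (ι p) ⟩
      ½ ℚ.* ι p + ½ ℚ.* ι p    ≡⟨ ℚ.*-distribʳ-+ (ι p) ½ ½ ⟨
      1ℚ ℚ.* ι p               ≡⟨ ℚ.*-identityˡ (ι p) ⟩
      ι p                      ∎) ,
    (begin
      ι p        ≤⟨ ι-mono-≤ (ℕ.n≤1+n p) ⟩
      ι n        ≡⟨ ℚ.*-identityˡ (ι n) ⟨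
      1ℚ ℚ.* ι n ∎)

corollary21 : (∀ n → ¬ ¬ (∃[ N ] NumberOfOrderDifferentXOS n N)) ×
    (∃[ l ] ∃[ u ] l ∈Θ id × u ∈Θ id ×
    ∃[ n₀ ] (∀ n → n₀ ≤ n → ∀ N → NumberOfOrderDifferentXOS n N →
    2 ^ (2 ^ l n) ≤ N × N ≤ 2 ^ (2 ^ u n)))
-- The special element takes one of the `n`, which leaves `pred n` for the lower bound and makes 1
-- the threshold.
corollary21 = number-exists , pred , (λ n → n ℕ.+ n) , pred-∈Θ , double-∈Θ , 1 ,
  λ where
    (suc m) _ N number@(rep , _ , different , _) →
      number-≥ m number , pairwiseOrderDifferent-≤ rep different
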